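{- Let $k\geq 2$ be an integer. For a non-negative integer $n$, let $B_{0,k}(n)$ be the number of partitions of $n$ in which each part is either even but $\not\equiv 2 \pmod{4k}$, or odd and $\equiv 1 \text{ or } 2k+1 \pmod{4k}$. Also, let $C_{0,k}(n)$ be the number of partitions of $n$ in which, if an odd part $2j+1$ is present, then none of the other parts are equal to any of $2j+1,2j+2,\dots,2j+2k-1$. Then $B_{0,k}(n) = C_{0,k}(n)$ for all $n$.
   Context: A partition of $n$ is a finite multiset of positive integers (its parts) with sum $n$; the empty partition is the only partition of $0$. "None of the other parts" refers to the remaining parts counted with multiplicity after removing one copy of $2j+1$; in particular, no odd part is repeated in a partition counted by $C_{0,k}(n)$. The list $2j+1,2j+2,\dots,2j+2k-1$ consists of all consecutive integers from $2j+1$ to $2j+2k-1$. -}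

module Defs where

open import Data.List.Base using (List; []; _∷_; length; filter; map; concatMap; upTo)
open import Data.List.Membership.Propositional using (_∈_; _─_; find)
open import Data.List.Membership.Propositional.Properties
  using (∈-map⁺; ∈-map⁻; ∈-upTo⁺; ∈-upTo⁻; ∈-concatMap⁺; ∈-concatMap⁻)
open import Data.List.Properties using (∷-injectiveˡ; ∷-injectiveʳ)
open import Data.List.Relation.Unary.All as All using (All; []; _∷_; all?)
import Data.List.Relation.Unary.All.Properties as Allₚ
open import Data.List.Relation.Unary.AllPairs as AllPairs using (AllPairs; []; _∷_)
import Data.List.Relation.Unary.AllPairs.Properties as AllPairsₚ
open import Data.List.Relation.Unary.Any as Any using (here; there)
open import Data.List.Relation.Unary.Unique.Propositional using (Unique)
import Data.List.Relation.Unary.Unique.Propositional.Properties as Uniqueₚ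
open import Data.Nat.Base
open import Data.Nat.Divisibility using (_∣_; _∣?_)
open import Data.Nat.ListAction using (sum)
open import Data.Nat.Properties
open import Data.Product.Base using (_×_; _,_; proj₁; proj₂)
open import Data.Sum.Base using (_⊎_)
open import Level using (Level)
open import Relation.Binary.PropositionalEquality
open import Relation.Nullary.Decidable using (Dec; yes; no; map′; ¬?; _×-dec_; _⊎-dec_; _→-dec_)
open import Relation.Nullary.Negation using (¬_)
open import Relation.Unary using (Pred; Decidable)

private variable
  ℓ : Level

-- A finite multiset of positive integers is represented by its unique
-- weakly decreasing listing.
record IsPartitionOf (n : ℕ) (p : List ℕ) : Set where
  constructor isPartition
  field
    decreasing : AllPairs _≥_ p
    positive   : All (1 ≤_) p
    total      : sum p ≡ n

-- `partitions≤ f m n` lists the partitions of n into parts at most m;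
-- f is fuel, and any f ≥ n suffices.
partitions≤ : (f m n : ℕ) → List (List ℕ)
partitions≤ f       m zero    = [] ∷ []
partitions≤ zero    m (suc n) = []
partitions≤ (suc f) m (suc n) =
  concatMap (λ i → map (suc i ∷_) (partitions≤ f (suc i) (n ∸ i))) (upTo (m ⊓ suc n))

partitions : ℕ → List (List ℕ)
partitions n = partitions≤ n n n

-- Number of partitions of n satisfying P. The lemmas `∈-partitions⁺`,
-- `∈-partitions⁻` and `partitions-unique` below show that `partitions n`
-- contains each partition of n exactly once.
#partitions : {P : Pred (List ℕ) ℓ} → Decidable P → ℕ → ℕ
#partitions P? n = length (filter P? (partitions n))

_≡_[mod_] : ℕ → ℕ → ℕ → Set
a ≡ b [mod m ] = m ∣ ∣ a - b ∣

_≡?_[mod_] : ∀ a b m → Dec (a ≡ b [mod m ])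
a ≡? b [mod m ] = m ∣? ∣ a - b ∣

Even Odd : ℕ → Set
Even a = 2 ∣ a
Odd  a = ¬ 2 ∣ a

BPart : ℕ → ℕ → Set
BPart k a =
    (Even a × ¬ (a ≡ 2 [mod 4 * k ]))
  ⊎ (Odd a × (a ≡ 1 [mod 4 * k ] ⊎ a ≡ 2 * k + 1 [mod 4 * k ]))

BCondition : ℕ → List ℕ → Set
BCondition k p = All (BPart k) p

-- `p ─ i` is p with the single occurrence i of 2j+1 removed, so further
-- copies of 2j+1 count as other parts.
CCondition : ℕ → List ℕ → Set
CCondition k p =
  ∀ j (i : 2 * j + 1 ∈ p) →
  All (λ a → ¬ (2 * j + 1 ≤ a × a ≤ 2 * j + 2 * k ∸ 1)) (p ─ i)

BCondition? : ∀ k → Decidable (BCondition k)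
BCondition? k = all? λ a →
    ((2 ∣? a) ×-dec ¬? (a ≡? 2 [mod 4 * k ]))
  ⊎-dec (¬? (2 ∣? a) ×-dec ((a ≡? 1 [mod 4 * k ]) ⊎-dec (a ≡? 2 * k + 1 [mod 4 * k ])))

private
  ∀∈? : ∀ (p : List ℕ) {Q : ∀ x → x ∈ p → Set ℓ} →
        (∀ x i → Dec (Q x i)) → Dec (∀ x i → Q x i)
  ∀∈? []      Q? = yes λ _ ()
  ∀∈? (y ∷ p) Q? = map′
    (λ { (q , qs) _ (here refl) → q ; (q , qs) x (there i) → qs x i })
    (λ f → f y (here refl) , λ x i → f x (there i))
    (Q? y (here refl) ×-dec ∀∈? p (λ x i → Q? x (there i)))

  j<2j+2 : ∀ j → j < suc (2 * j + 1)
  j<2j+2 j = s≤s (≤-trans (m≤m+n j (j + 0)) (m≤m+n (2 * j) 1))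

CCondition? : ∀ k → Decidable (CCondition k)
CCondition? k p = map′
  (λ f j i → f (2 * j + 1) i {j} (j<2j+2 j) refl)
  (λ { f _ i {j} _ refl → f j i })
  (∀∈? p {λ x i → ∀ {j} → j < suc x → x ≡ 2 * j + 1 → Allowed j (p ─ i)}
    λ x i → allUpTo? (λ j → (x ≟ 2 * j + 1) →-dec all? (allowed? j) (p ─ i)) (suc x))
  where
  Allowed : ℕ → List ℕ → Set
  Allowed j = All λ a → ¬ (2 * j + 1 ≤ a × a ≤ 2 * j + 2 * k ∸ 1)
  allowed? : ∀ j → Decidable (λ a → ¬ (2 * j + 1 ≤ a × a ≤ 2 * j + 2 * k ∸ 1))
  allowed? j a = ¬? ((2 * j + 1 ≤? a) ×-dec (a ≤? 2 * j + 2 * k ∸ 1))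

B₀ : ℕ → ℕ → ℕ
B₀ k = #partitions (BCondition? k)

C₀ : ℕ → ℕ → ℕ
C₀ k = #partitions (CCondition? k)

private
  suc-total : ∀ {i n} → i < suc n → suc i + (n ∸ i) ≡ suc n
  suc-total (s≤s i≤n) = cong suc (m+[n∸m]≡n i≤n)

  ∈-partitions≤⁺ : ∀ f m n p → n ≤ f → IsPartitionOf n p → All (_≤ m) p → p ∈ partitions≤ f m n
  ∈-partitions≤⁺ f m zero [] _ _ _ = here refl
  ∈-partitions≤⁺ f m zero (zero ∷ p) _ (isPartition _ (() ∷ _) _) _
  ∈-partitions≤⁺ f m (suc n) (zero ∷ p) _ (isPartition _ (() ∷ _) _) _
  ∈-partitions≤⁺ (suc f) m (suc n) (suc i ∷ p) (s≤s n≤f)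
    (isPartition (d ∷ ds) (_ ∷ pos) eq) (i<m ∷ _) =
    ∈-concatMap⁺ (λ i → map (suc i ∷_) (partitions≤ f (suc i) (n ∸ i)))
      (Any.map (λ { refl → ∈-map⁺ (suc i ∷_) (∈-partitions≤⁺ f (suc i) (n ∸ i) p
                  (≤-trans (m∸n≤m n i) n≤f) (isPartition ds pos sum≡) d) })
               (∈-upTo⁺ (⊓-glb i<m i<1+n)))
    where
    eq′ : i + sum p ≡ n
    eq′ = suc-injective eq
    i<1+n : i < suc n
    i<1+n = s≤s (subst (i ≤_) eq′ (m≤m+n i (sum p)))
    sum≡ : sum p ≡ n ∸ i
    sum≡ = trans (sym (m+n∸m≡n i (sum p))) (cong (_∸ i) eq′)

  ∈-partitions≤⁻ : ∀ f m n {p} → p ∈ partitions≤ f m n → IsPartitionOf n p × All (_≤ m) p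
  ∈-partitions≤⁻ f m zero (here refl) = isPartition [] [] refl , []
  ∈-partitions≤⁻ (suc f) m (suc n) {p} p∈
    with find (∈-concatMap⁻ _ {xs = upTo (m ⊓ suc n)} p∈)
  ... | i , i∈ , q with ∈-map⁻ (suc i ∷_) q
  ... | r , r∈ , refl with ∈-partitions≤⁻ f (suc i) (n ∸ i) r∈
  ... | isPartition d pos eq , r≤ =
    isPartition (r≤ ∷ d) (s≤s z≤n ∷ pos)
      (trans (cong (suc i +_) eq) (suc-total (≤-trans i< (m⊓n≤n m (suc n)))))
    , i<m ∷ All.map (λ a≤ → ≤-trans a≤ i<m) r≤
    where
    i< : i < m ⊓ suc n
    i< = ∈-upTo⁻ i∈
    i<m : i < m
    i<m = ≤-trans i< (m⊓n≤m m (suc n))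

  partitions≤-unique : ∀ f m n → Unique (partitions≤ f m n)
  partitions≤-unique f       m zero    = [] ∷ []
  partitions≤-unique zero    m (suc n) = []
  partitions≤-unique (suc f) m (suc n) = Uniqueₚ.concat⁺
    (Allₚ.map⁺ (All.tabulate λ {i} _ →
      Uniqueₚ.map⁺ ∷-injectiveʳ (partitions≤-unique f (suc i) (n ∸ i))))
    (AllPairsₚ.map⁺ (AllPairs.map disjoint (Uniqueₚ.upTo⁺ (m ⊓ suc n))))
    where
    disjoint : ∀ {i j} → i ≢ j → ∀ {p} →
               ¬ (p ∈ map (suc i ∷_) (partitions≤ f (suc i) (n ∸ i))
                × p ∈ map (suc j ∷_) (partitions≤ f (suc j) (n ∸ j)))
    disjoint i≢j (p∈₁ , p∈₂) with ∈-map⁻ _ p∈₁ | ∈-map⁻ _ p∈₂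
    ... | _ , _ , refl | _ , _ , eq = i≢j (suc-injective (∷-injectiveˡ eq))

  part≤sum : ∀ p → All (_≤ sum p) p
  part≤sum []      = []
  part≤sum (a ∷ p) =
    m≤m+n a (sum p) ∷ All.map (λ b≤ → ≤-trans b≤ (m≤n+m (sum p) a)) (part≤sum p)

∈-partitions⁺ : ∀ {n p} → IsPartitionOf n p → p ∈ partitions n
∈-partitions⁺ {n} {p} h =
  ∈-partitions≤⁺ n n n p ≤-refl h (subst (λ s → All (_≤ s) p) (IsPartitionOf.total h) (part≤sum p))

∈-partitions⁻ : ∀ {n p} → p ∈ partitions n → IsPartitionOf n p
∈-partitions⁻ {n} p∈ = proj₁ (∈-partitions≤⁻ n n n p∈)

partitions-unique : ∀ n → Unique (partitions n)
partitions-unique n = partitions≤-unique n n n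

{-# OPTIONS --safe #-}

-- On a weakly decreasing list the C-condition is local: an odd part y may
-- directly follow x only if y + 2k ≤ x + 1. Hence the generating functions e(a)
-- of the C-partitions that may follow the part 2a satisfy, for s = 1,
--   e(a) = q^2a e(a) + e(a − 1) + q^s q^2(a−k) e(a − k).
-- If f satisfies this recurrence with s + 2k in place of s, then
-- a ↦ f(a) + q^s f(a − k) satisfies it with s. Since the recurrence with s → ∞ is
-- that of partitions into even parts, the limit of e(a) is
-- ∏ᵢ (1 + q^(2ki+1)) / ∏ⱼ (1 − q^2j). Glaisher's exchange
-- 1 / (1 − q^o) = (1 + q^o) / (1 − q^2o), applied to each o = 2ki + 1, turns the
-- generating function of B-partitions into the same product.

module Submission where

open import Defs
open import Data.Bool.Base using (true; false)
open import Data.Empty using (⊥-elim)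
open import Data.List.Base
  using (List; []; _∷_; _++_; _∷ʳ_; length; filter; map; concat; concatMap; upTo)
open import Data.List.Membership.Propositional using (_∈_; _─_)
open import Data.List.Properties
  using (length-++; filter-++; filter-none; ++-identityʳ; concatMap-++; upTo-∷ʳ; map-cong-local)
open import Data.List.Relation.Unary.All as All using (All; []; _∷_)
open import Data.List.Relation.Unary.AllPairs as AllPairs using (AllPairs; []; _∷_)
open import Data.List.Relation.Unary.Any using (here; there)
open import Data.List.Relation.Unary.Linked as Linked using (Linked; []; [-]; _∷_; linked?)
open import Data.Nat.Base hiding (parity)
open import Data.Nat.Divisibility
open import Data.Nat.Induction using (<-rec)
open import Data.Nat.ListAction using (sum)
open import Data.Nat.Properties
open import Data.Nat.Tactic.RingSolver using (solve-∀)
open import Data.Product.Base using (_×_; _,_; proj₁; proj₂; ∃)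
open import Data.Sum.Base using (_⊎_; inj₁; inj₂)
open import Function.Base using (id; _∘_)
open import Function.Bundles using (_⇔_; mk⇔; Equivalence)
open import Level using (0ℓ)
open import Relation.Binary.Core using (Rel)
open import Relation.Binary.Definitions using (tri<; tri≈; tri>) renaming (Decidable to Decidable₂)
open import Relation.Binary.PropositionalEquality
open import Relation.Nullary.Decidable using (yes; no; ¬?; _×-dec_; _⊎-dec_; _→-dec_; does)
open import Relation.Nullary.Negation using (¬_; contradiction)
open import Relation.Unary using (Pred; Decidable)

open ≡-Reasoning

-- Power series in q as coefficient functions, compared up to a finite order.

Series : Set
Series = ℕ → ℕ

infix 4 _≈[_]_

-- Congruence modulo q^(N+1).
_≈[_]_ : Series → ℕ → Series → Set
f ≈[ N ] g = ∀ n → n ≤ N → f n ≡ g n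

-- Multiplication by q^a.
shift : ℕ → Series → Series
shift zero    f n       = f n
shift (suc a) f zero    = 0
shift (suc a) f (suc n) = shift a f n

-- Agreement is demanded only for m + a ≤ n, the coefficients that reach q^n. For a ≥ 1 this gives m
-- < n, which makes the well-founded induction in `geometric-unique` possible.
shift-cong : ∀ a {f g} n → (∀ m → m + a ≤ n → f m ≡ g m) → shift a f n ≡ shift a g n
shift-cong zero    n       h = h n (≤-reflexive (+-identityʳ n))
shift-cong (suc a) zero    h = refl
shift-cong (suc a) (suc n) h =
  shift-cong a n λ m m+a≤n → h m (subst (_≤ suc n) (sym (+-suc m a)) (s≤s m+a≤n))

shift-cong-≈ : ∀ a {f g N} → f ≈[ N ] g → shift a f ≈[ N ] shift a g
shift-cong-≈ a f≈g n n≤N =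
  shift-cong a n λ m m+a≤n → f≈g m (≤-trans (≤-trans (m≤m+n m a) m+a≤n) n≤N)

shift-distrib-+ : ∀ a f g n → shift a (λ m → f m + g m) n ≡ shift a f n + shift a g n
shift-distrib-+ zero    f g n       = refl
shift-distrib-+ (suc a) f g zero    = refl
shift-distrib-+ (suc a) f g (suc n) = shift-distrib-+ a f g n

shift-shift : ∀ a b f n → shift a (shift b f) n ≡ shift (a + b) f n
shift-shift zero    b f n       = refl
shift-shift (suc a) b f zero    = refl
shift-shift (suc a) b f (suc n) = shift-shift a b f n

shift-comm : ∀ a b f n → shift a (shift b f) n ≡ shift b (shift a f) n
shift-comm a b f n = begin
  shift a (shift b f) n  ≡⟨ shift-shift a b f n ⟩
  shift (a + b) f n      ≡⟨ cong (λ c → shift c f n) (+-comm a b) ⟩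
  shift (b + a) f n      ≡⟨ shift-shift b a f n ⟨
  shift b (shift a f) n  ∎

shift-< : ∀ {a} f {n} → n < a → shift a f n ≡ 0
shift-< {suc a} f {zero}  _         = refl
shift-< {suc a} f {suc n} (s≤s n<a) = shift-< f n<a

shift-0 : ∀ a n → shift a (λ _ → 0) n ≡ 0
shift-0 zero    n       = refl
shift-0 (suc a) zero    = refl
shift-0 (suc a) (suc n) = shift-0 a n

shift-≥ : ∀ a f n → shift a f (a + n) ≡ f n
shift-≥ zero    f n = refl
shift-≥ (suc a) f n = shift-≥ a f n

shift-interchange : ∀ a b (F : ℕ → Series) m n →
  shift a (λ j → shift b (λ i → F i j) m) n ≡ shift b (λ i → shift a (F i) n) m
shift-interchange a zero    F m       n = refl
shift-interchange a (suc b) F (suc m) n = shift-interchange a b F m n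
shift-interchange a (suc b) F zero    n = shift-0 a n

-- The equation f = h + q^a f determines f, as division by 1 − q^a would.
geometric-unique : ∀ a {f g h h′ N} → 1 ≤ a → h ≈[ N ] h′ →
  f ≈[ N ] (λ n → h n + shift a f n) → g ≈[ N ] (λ n → h′ n + shift a g n) → f ≈[ N ] g
geometric-unique a {f} {g} {h} {h′} {N} 1≤a h≈ f≈ g≈ = <-rec _ λ n rec n≤N → begin
  f n                ≡⟨ f≈ n n≤N ⟩
  h n + shift a f n  ≡⟨ cong₂ _+_ (h≈ n n≤N) (shift-cong a n λ m m+a≤n →
                          let m<n = ≤-trans (≤-trans (≤-reflexive (+-comm 1 m)) (+-monoʳ-≤ m 1≤a)) m+a≤n
                          in rec m<n (≤-trans (<⇒≤ m<n) n≤N)) ⟩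
  h′ n + shift a g n ≡⟨ g≈ n n≤N ⟨
  g n                ∎

-- Bivariate series and the recurrence.

-- A sequence of series F 0, F 1, … is read as the bivariate series Σ (F a) x^a:
-- Z multiplies by a power of q, X by a power of x, and σ substitutes x q² for x.
Z X : ℕ → (ℕ → Series) → ℕ → Series
Z s F a   = shift s (F a)
X k F a n = shift k (λ b → F b n) a

σ : (ℕ → Series) → ℕ → Series
σ F a = shift (2 * a) (F a)

X-cong : ∀ k {F G : ℕ → Series} a n → (∀ b → F b n ≡ G b n) → X k F a n ≡ X k G a n
X-cong k a n h = shift-cong k a λ b _ → h b

Z-X : ∀ s k F a n → Z s (X k F) a n ≡ X k (Z s F) a n
Z-X s k F a n = shift-interchange s k F a n

X-comm : ∀ j k F a n → X j (X k F) a n ≡ X k (X j F) a n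
X-comm j k F a n = shift-comm j k (λ b → F b n) a

-- Substituting x q² for x turns the factor x^k into q^2k x^k. For a < k both sides vanish; for a =
-- k + b the exponent 2a splits as 2k + 2b.
σ-X : ∀ k F a n → σ (X k F) a n ≡ Z (2 * k) (X k (σ F)) a n
σ-X k F a n with k ≤? a
... | no k≰a = trans
  (shift-cong (2 * a) n λ m _ → shift-< _ (≰⇒> k≰a))
  (trans (shift-0 (2 * a) n)
  (sym (trans (Z-X (2 * k) k (σ F) a n) (shift-< _ (≰⇒> k≰a)))))
... | yes k≤a with b , refl ← m≤n⇒∃[o]m+o≡n k≤a = begin
  shift (2 * (k + b)) (λ m → shift k (λ b → F b m) (k + b)) n
    ≡⟨ shift-cong (2 * (k + b)) n (λ m _ → shift-≥ k _ b) ⟩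
  shift (2 * (k + b)) (F b) n
    ≡⟨ cong (λ c → shift c (F b) n) (*-distribˡ-+ 2 k b) ⟩
  shift (2 * k + 2 * b) (F b) n
    ≡⟨ shift-shift (2 * k) (2 * b) (F b) n ⟨
  shift (2 * k) (σ F b) n
    ≡⟨ shift-cong (2 * k) n (λ m _ → shift-≥ k _ b) ⟨
  Z (2 * k) (X k (σ F)) (k + b) n ∎

-- As a functional equation modulo q^(N+1): F(x) = F(x q²) + x F(x) + q^s x^k F(x q²).
Recurrence : (N k s : ℕ) → (ℕ → Series) → Set
Recurrence N k s F = ∀ a →
  F a ≈[ N ] λ n → σ F a n + X 1 F a n + Z s (X k (σ F)) a n

-- Multiplication by 1 + q^s x^k.
twist : (k s : ℕ) → (ℕ → Series) → ℕ → Series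
twist k s F a n = F a n + Z s (X k F) a n

-- With F′ = (1 + q^s x^k) F, the hypothesis reads F(x) - x F(x) = (1 + q^(s+2k) x^k) F(x q²) = F′(x
-- q²). Multiplying by 1 + q^s x^k gives the recurrence for F′. The computation below expands this
-- without subtraction.
recurrence-twist : ∀ {N k s F} → Recurrence N k (s + 2 * k) F → Recurrence N k s (twist k s F)
recurrence-twist {N} {k} {s} {F} rec a n n≤N = begin
  F a n + Z s (X k F) a n
    ≡⟨ cong₂ _+_ (rec a n n≤N) ZXF ⟩
  (σ F a n + X 1 F a n + Z t (X k (σ F)) a n)
    + (Z s (X k (σ F)) a n + Z s (X k (X 1 F)) a n + Z s (X k (Z t (X k (σ F)))) a n)
    ≡⟨ rearrange (σ F a n) (X 1 F a n) _ (Z s (X k (σ F)) a n) _ _ ⟩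
  (σ F a n + Z t (X k (σ F)) a n)
    + (X 1 F a n + Z s (X k (X 1 F)) a n)
    + (Z s (X k (σ F)) a n + Z s (X k (Z t (X k (σ F)))) a n)
    ≡⟨ cong₂ _+_ (cong₂ _+_ (σF′ a n) XF′) ZXσF′ ⟨
  σ F′ a n + X 1 F′ a n + Z s (X k (σ F′)) a n ∎
  where
  t = s + 2 * k
  F′ = twist k s F

  rearrange : ∀ a b c d e f → (a + b + c) + (d + e + f) ≡ (a + c) + (b + e) + (d + f)
  rearrange = solve-∀

  ZX-+ : ∀ G H → Z s (X k (λ b m → G b m + H b m)) a n ≡ Z s (X k G) a n + Z s (X k H) a n
  ZX-+ G H = trans (shift-cong s n λ m _ → shift-distrib-+ k _ _ a) (shift-distrib-+ s _ _ n)

  ZXF : Z s (X k F) a n ≡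
        Z s (X k (σ F)) a n + Z s (X k (X 1 F)) a n + Z s (X k (Z t (X k (σ F)))) a n
  ZXF = begin
    Z s (X k F) a n
      ≡⟨ shift-cong-≈ s (λ m m≤N → X-cong k {F} {G} a m λ b → rec b m m≤N) n n≤N ⟩
    Z s (X k G) a n
      ≡⟨ ZX-+ (λ b m → σ F b m + X 1 F b m) (Z t (X k (σ F))) ⟩
    Z s (X k (λ b m → σ F b m + X 1 F b m)) a n + Z s (X k (Z t (X k (σ F)))) a n
      ≡⟨ cong (_+ Z s (X k (Z t (X k (σ F)))) a n) (ZX-+ (σ F) (X 1 F)) ⟩
    Z s (X k (σ F)) a n + Z s (X k (X 1 F)) a n + Z s (X k (Z t (X k (σ F)))) a n ∎
    where
    G : ℕ → Series
    G b m = σ F b m + X 1 F b m + Z t (X k (σ F)) b m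

  σZXF : ∀ a n → σ (Z s (X k F)) a n ≡ Z t (X k (σ F)) a n
  σZXF a n = begin
    σ (Z s (X k F)) a n                ≡⟨ shift-comm (2 * a) s _ n ⟩
    shift s (σ (X k F) a) n            ≡⟨ shift-cong s n (λ m _ → σ-X k F a m) ⟩
    Z s (Z (2 * k) (X k (σ F))) a n    ≡⟨ shift-shift s (2 * k) _ n ⟩
    Z t (X k (σ F)) a n                ∎

  σF′ : ∀ a n → σ F′ a n ≡ σ F a n + Z t (X k (σ F)) a n
  σF′ a n = trans (shift-distrib-+ (2 * a) _ _ n) (cong (σ F a n +_) (σZXF a n))

  XF′ : X 1 F′ a n ≡ X 1 F a n + Z s (X k (X 1 F)) a n
  XF′ = trans (shift-distrib-+ 1 _ _ a) (cong (X 1 F a n +_) (trans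
    (sym (Z-X s 1 (X k F) a n)) (shift-cong s n λ m _ → X-comm 1 k F a m)))

  ZXσF′ : Z s (X k (σ F′)) a n ≡ Z s (X k (σ F)) a n + Z s (X k (Z t (X k (σ F)))) a n
  ZXσF′ = trans
    (shift-cong s n λ m _ →
      X-cong k {σ F′} {λ b j → σ F b j + Z t (X k (σ F)) b j} a m
        λ b → σF′ b m)
    (ZX-+ (σ F) (Z t (X k (σ F))))

-- At a = 0 the recurrence is a tautology, so F 0 has to be given. For a > 0 the terms in F (a - 1)
-- and F (a - k) are known by induction, and what remains is division by 1 - q^2a.
recurrence-unique : ∀ {N k s F G} → 1 ≤ k → Recurrence N k s F → Recurrence N k s G →
  F 0 ≈[ N ] G 0 → ∀ a → F a ≈[ N ] G a
recurrence-unique {N} {suc k} {s} {F} {G} _ recF recG F₀≈G₀ = <-rec _ step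
  where
  step : ∀ a → (∀ {b} → b < a → F b ≈[ N ] G b) → F a ≈[ N ] G a
  step zero    _  = F₀≈G₀
  step (suc a) ih = geometric-unique (2 * suc a) (s≤s z≤n) rest (split recF) (split recG)
    where
    rotate : ∀ a b c → a + b + c ≡ b + c + a
    rotate = solve-∀
    split : ∀ {H} → Recurrence N (suc k) s H →
      H (suc a) ≈[ N ] λ n → X 1 H (suc a) n + Z s (X (suc k) (σ H)) (suc a) n + σ H (suc a) n
    split {H} rec n n≤N = trans (rec (suc a) n n≤N)
      (rotate (σ H (suc a) n) (X 1 H (suc a) n) (Z s (X (suc k) (σ H)) (suc a) n))
    rest : (λ n → X 1 F (suc a) n + Z s (X (suc k) (σ F)) (suc a) n) ≈[ N ]
           (λ n → X 1 G (suc a) n + Z s (X (suc k) (σ G)) (suc a) n)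
    rest n n≤N = cong₂ _+_ (ih ≤-refl n n≤N)
      (shift-cong-≈ s (λ m m≤N → shift-cong k a λ b b+k≤a →
        shift-cong-≈ (2 * b) (ih (s≤s (≤-trans (m≤m+n b k) b+k≤a))) m m≤N) n n≤N)

-- Listing and filtering partitions by largest part.

partitions≤-fuel : ∀ f f′ m n → n ≤ f → n ≤ f′ → partitions≤ f m n ≡ partitions≤ f′ m n
partitions≤-fuel f       f′       m zero    _         _          = refl
partitions≤-fuel (suc f) (suc f′) m (suc n) (s≤s n≤f) (s≤s n≤f′) =
  cong concat (map-cong-local (All.tabulate {xs = upTo (m ⊓ suc n)} λ {i} _ →
    cong (map (suc i ∷_)) (partitions≤-fuel f f′ (suc i) (n ∸ i)
      (≤-trans (m∸n≤m n i) n≤f) (≤-trans (m∸n≤m n i) n≤f′))))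

partitions≤-cutoff : ∀ m n → n ≤ m → partitions≤ n (suc m) n ≡ partitions≤ n m n
partitions≤-cutoff m zero    _   = refl
partitions≤-cutoff m (suc n) n<m =
  cong (λ j → concatMap (λ i → map (suc i ∷_) (partitions≤ n (suc i) (n ∸ i))) (upTo j))
    (trans (m≥n⇒m⊓n≡n (m≤n⇒m≤1+n n<m)) (sym (m≥n⇒m⊓n≡n n<m)))

-- The listing runs through the largest parts in increasing order, so those with largest part m + 1
-- come last. Fuel is reset to the remaining sum n ∸ m, the form used in `tails`.
partitions≤-snoc : ∀ m n → m ≤ n → partitions≤ (suc n) (suc m) (suc n) ≡
  partitions≤ (suc n) m (suc n) ++ map (suc m ∷_) (partitions≤ (n ∸ m) (suc m) (n ∸ m))
partitions≤-snoc m n m≤n = begin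
  concatMap g (upTo (suc (m ⊓ n)))
    ≡⟨ cong (λ j → concatMap g (upTo (suc j))) (m≤n⇒m⊓n≡m m≤n) ⟩
  concatMap g (upTo (suc m))
    ≡⟨ cong (concatMap g) (upTo-∷ʳ m) ⟨
  concatMap g (upTo m ∷ʳ m)
    ≡⟨ concatMap-++ g (upTo m) (m ∷ []) ⟩
  concatMap g (upTo m) ++ (g m ++ [])
    ≡⟨ cong₂ _++_ (cong (λ j → concatMap g (upTo j)) (sym (m≤n⇒m⊓n≡m (m≤n⇒m≤1+n m≤n))))
         (trans (++-identityʳ (g m)) (cong (map (suc m ∷_))
           (partitions≤-fuel n (n ∸ m) (suc m) (n ∸ m) (m∸n≤m n m) ≤-refl))) ⟩
  concatMap g (upTo (m ⊓ suc n)) ++ map (suc m ∷_) (partitions≤ (n ∸ m) (suc m) (n ∸ m)) ∎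
  where
  g : ℕ → List (List ℕ)
  g i = map (suc i ∷_) (partitions≤ n (suc i) (n ∸ i))

length-filter-cong : ∀ {A : Set} {P Q : Pred A 0ℓ} (P? : Decidable P) (Q? : Decidable Q) xs →
  (∀ {x} → x ∈ xs → P x ⇔ Q x) → length (filter P? xs) ≡ length (filter Q? xs)
length-filter-cong P? Q? []       P⇔Q = refl
length-filter-cong P? Q? (x ∷ xs) P⇔Q
  with P? x | Q? x | length-filter-cong P? Q? xs (P⇔Q ∘ there)
... | yes _ | yes _ | ih = cong suc ih
... | no  _ | no  _ | ih = ih
... | yes p | no ¬q | _  = contradiction (Equivalence.to (P⇔Q (here refl)) p) ¬q
... | no ¬p | yes q | _  = contradiction (Equivalence.from (P⇔Q (here refl)) q) ¬p

length-filter-map : ∀ {A B : Set} {P : Pred B 0ℓ} (P? : Decidable P) (f : A → B) xs →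
  length (filter P? (map f xs)) ≡ length (filter (P? ∘ f) xs)
length-filter-map P? f []       = refl
length-filter-map P? f (x ∷ xs) with does (P? (f x))
... | true  = cong suc (length-filter-map P? f xs)
... | false = length-filter-map P? f xs

-- Counting partitions under a condition on consecutive parts.

one : Series
one zero    = 1
one (suc _) = 0

module _ {Q : Rel ℕ 0ℓ} (Q? : Decidable₂ Q) where

  -- Partitions into parts at most m that may follow the part x, when a part y
  -- may directly follow a larger or equal part x only if Q x y.
  tails : (x m : ℕ) → Series
  tails x m n = length (filter (λ p → linked? Q? (x ∷ p)) (partitions≤ n m n))

  tails-zero : ∀ x n → tails x 0 n ≡ one n
  tails-zero x zero    = refl
  tails-zero x (suc n) = refl

  private
    tails-snoc : ∀ x m n → m ≤ n → tails x (suc m) (suc n) ≡ tails x m (suc n) +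
      length (filter (λ p → linked? Q? (x ∷ suc m ∷ p)) (partitions≤ (n ∸ m) (suc m) (n ∸ m)))
    tails-snoc x m n m≤n = begin
      length (filter P? (partitions≤ (suc n) (suc m) (suc n)))
        ≡⟨ cong (length ∘ filter P?) (partitions≤-snoc m n m≤n) ⟩
      length (filter P? (ps ++ map (suc m ∷_) qs))
        ≡⟨ cong length (filter-++ P? ps _) ⟩
      length (filter P? ps ++ filter P? (map (suc m ∷_) qs))
        ≡⟨ length-++ (filter P? ps) ⟩
      tails x m (suc n) + length (filter P? (map (suc m ∷_) qs))
        ≡⟨ cong (tails x m (suc n) +_) (length-filter-map P? (suc m ∷_) qs) ⟩
      tails x m (suc n) + length (filter (P? ∘ (suc m ∷_)) qs) ∎
      where
      P? = λ p → linked? Q? (x ∷ p)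
      ps = partitions≤ (suc n) m (suc n)
      qs = partitions≤ (n ∸ m) (suc m) (n ∸ m)

  tails-cutoff : ∀ x m n → n ≤ m → tails x (suc m) n ≡ tails x m n
  tails-cutoff x m n n≤m = cong (length ∘ filter _) (partitions≤-cutoff m n n≤m)

  tails-suc-no : ∀ {x m} → ¬ Q x (suc m) → ∀ n → tails x (suc m) n ≡ tails x m n
  tails-suc-no         ¬q zero    = refl
  tails-suc-no {x} {m} ¬q (suc n) with m ≤? n
  ... | no m≰n  = tails-cutoff x m (suc n) (≰⇒> m≰n)
  ... | yes m≤n = trans (tails-snoc x m n m≤n) (trans
    (cong (λ ps → tails x m (suc n) + length ps)
      (filter-none _ (All.universal (λ _ → ¬q ∘ Linked.head) (partitions≤ (n ∸ m) (suc m) (n ∸ m)))))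
    (+-identityʳ _))

  -- The added partitions begin with m + 1, and what follows is constrained by that part alone: x
  -- drops out of the shifted series.
  tails-suc-yes : ∀ {x m} → Q x (suc m) → ∀ n →
    tails x (suc m) n ≡ tails x m n + shift (suc m) (tails (suc m) (suc m)) n
  tails-suc-yes         q zero    = refl
  tails-suc-yes {x} {m} q (suc n) with m ≤? n
  ... | no m≰n  = trans (tails-cutoff x m (suc n) (≰⇒> m≰n))
    (sym (trans (cong (tails x m (suc n) +_) (shift-< _ (≰⇒> m≰n))) (+-identityʳ _)))
  ... | yes m≤n = trans (tails-snoc x m n m≤n) (cong (tails x m (suc n) +_) (trans
      (length-filter-cong _ _ (partitions≤ (n ∸ m) (suc m) (n ∸ m)) λ _ → mk⇔ Linked.tail (q ∷_))
      (sym (trans (cong (shift m _) (sym (m+[n∸m]≡n m≤n)))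
        (shift-≥ m (tails (suc m) (suc m)) (n ∸ m))))))

-- A first part y contributes the same series whatever admissible part precedes it. Predecessors
-- that admit the same y in the range m < y ≤ m + d therefore gain equally, and the difference c
-- persists.
tails-agree : ∀ {Q : Rel ℕ 0ℓ} (Q? : Decidable₂ Q) {x x′} m d n {c} →
  (∀ y → m < y → y ≤ m + d → Q x y ⇔ Q x′ y) →
  tails Q? x m n ≡ tails Q? x′ m n + c →
  tails Q? x (m + d) n ≡ tails Q? x′ (m + d) n + c
tails-agree Q?          m zero    n     agr h rewrite +-identityʳ m = h
tails-agree Q? {x} {x′} m (suc d) n {c} agr h rewrite +-suc m d
  with Q? x (suc (m + d)) | Q? x′ (suc (m + d))
     | tails-agree Q? {x} {x′} m d n (λ y m<y y≤ → agr y m<y (m≤n⇒m≤1+n y≤)) h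
... | no ¬q | no ¬q′ | ih =
  trans (tails-suc-no Q? ¬q n) (trans ih (cong (_+ c) (sym (tails-suc-no Q? ¬q′ n))))
... | yes q | no ¬q′ | _ =
  contradiction (Equivalence.to (agr _ (s≤s (m≤m+n m d)) ≤-refl) q) ¬q′
... | no ¬q | yes q′ | _ =
  contradiction (Equivalence.from (agr _ (s≤s (m≤m+n m d)) ≤-refl) q′) ¬q
... | yes q | yes q′ | ih = begin
  tails Q? x (suc M) n
    ≡⟨ tails-suc-yes Q? q n ⟩
  tails Q? x M n + shift (suc M) (tails Q? (suc M) (suc M)) n
    ≡⟨ cong (_+ shift (suc M) (tails Q? (suc M) (suc M)) n) ih ⟩
  tails Q? x′ M n + c + shift (suc M) (tails Q? (suc M) (suc M)) n
    ≡⟨ swap (tails Q? x′ M n) c _ ⟩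
  tails Q? x′ M n + shift (suc M) (tails Q? (suc M) (suc M)) n + c
    ≡⟨ cong (_+ c) (tails-suc-yes Q? q′ n) ⟨
  tails Q? x′ (suc M) n + c ∎
  where
  M = m + d
  swap : ∀ a b c → a + b + c ≡ a + c + b
  swap = solve-∀

tails-agree₀ : ∀ {Q : Rel ℕ 0ℓ} (Q? : Decidable₂ Q) {x x′} m n →
  (∀ y → 1 ≤ y → y ≤ m → Q x y ⇔ Q x′ y) → tails Q? x m n ≡ tails Q? x′ m n
tails-agree₀ Q? m n agr = trans (tails-agree Q? 0 m n agr
  (trans (tails-zero Q? _ n) (sym (trans (+-identityʳ _) (tails-zero Q? _ n)))))
  (+-identityʳ _)

tails-stable : ∀ {Q : Rel ℕ 0ℓ} (Q? : Decidable₂ Q) x m d n → n ≤ m →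
  tails Q? x (m + d) n ≡ tails Q? x m n
tails-stable Q? x m zero    n n≤m = cong (λ j → tails Q? x j n) (+-identityʳ m)
tails-stable Q? x m (suc d) n n≤m = trans (cong (λ j → tails Q? x j n) (+-suc m d))
  (trans (tails-cutoff Q? x (m + d) n (≤-trans n≤m (m≤m+n m d))) (tails-stable Q? x m d n n≤m))

-- Parity, and the C-condition as a condition on neighbouring parts.

even∨odd : ∀ n → (∃ λ j → n ≡ 2 * j) ⊎ (∃ λ j → n ≡ 2 * j + 1)
even∨odd zero    = inj₁ (0 , refl)
even∨odd (suc n) with even∨odd n
... | inj₁ (j , refl) = inj₂ (j , +-comm 1 (2 * j))
... | inj₂ (j , refl) = inj₁ (suc j , trans (cong suc (+-comm (2 * j) 1)) (sym (*-suc 2 j)))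

2*-even : ∀ j → Even (2 * j)
2*-even j = m∣m*n j

2*+1-odd : ∀ j → Odd (2 * j + 1)
2*+1-odd j 2∣ with () ← ∣1⇒≡1 (∣m+n∣m⇒∣n 2∣ (2*-even j))

1+2*-odd : ∀ j → Odd (1 + 2 * j)
1+2*-odd j = subst Odd (+-comm (2 * j) 1) (2*+1-odd j)

odd⇒2*+1 : ∀ {y} → Odd y → ∃ λ j → y ≡ 2 * j + 1
odd⇒2*+1 {y} odd with even∨odd y
... | inj₁ (j , refl) = contradiction (2*-even j) odd
... | inj₂ y≡         = y≡

+1-swap : ∀ a b → a + 1 + b ≡ suc (a + b)
+1-swap = solve-∀

All-─ : ∀ {R : Rel ℕ 0ℓ} {p o} → AllPairs R p → (i : o ∈ p) → All (λ a → R a o ⊎ R o a) (p ─ i)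
All-─ (r ∷ rs) (here refl) = All.map inj₂ r
All-─ (r ∷ rs) (there i)   = inj₁ (All.lookup r i) ∷ All-─ rs i

module _ (k : ℕ) where

  -- On weakly decreasing lists, CCondition k says that consecutive parts x ≥ y
  -- satisfy CNext x y.
  CNext : Rel ℕ 0ℓ
  CNext x y = Odd y → y + 2 * k ≤ suc x

  CNext? : Decidable₂ CNext
  CNext? x y = ¬? (2 ∣? y) →-dec (y + 2 * k ≤? suc x)

  CCondition⇒Linked : ∀ {p} → AllPairs _≥_ p → CCondition k p → Linked CNext p
  CCondition⇒Linked []      c = []
  CCondition⇒Linked (_ ∷ []) c = [-]
  CCondition⇒Linked {y ∷ z ∷ p} ((y≥z ∷ _) ∷ ds) c =
    next ∷ CCondition⇒Linked ds λ j i → All.tail (c j (there i))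
    where
    next : CNext y z
    next odd with j , refl ← odd⇒2*+1 odd | 2 * j + 1 + 2 * k ≤? suc y
    ... | yes z+2k≤1+y = z+2k≤1+y
    -- If the gap is too small, y lies in the range from z to z + 2k - 2 forbidden by the odd part z
    -- = 2j + 1, and y heads the list left after removing z.
    ... | no  z+2k≰1+y = contradiction
      (y≥z , <⇒≤pred (s≤s⁻¹ (subst (suc (suc y) ≤_) (+1-swap (2 * j) (2 * k)) (≰⇒> z+2k≰1+y))))
      (All.head (c j (there (here refl))))

  -- `CNext` is monotone in its first argument, so on a decreasing list the bound against a
  -- neighbour passes to all earlier parts.
  Linked⇒AllPairs-CNext : ∀ {p} → AllPairs _≥_ p → Linked CNext p → AllPairs CNext p
  Linked⇒AllPairs-CNext []       []  = []
  Linked⇒AllPairs-CNext (_ ∷ _)  [-] = [] ∷ []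
  Linked⇒AllPairs-CNext ((x≥y ∷ _) ∷ ds) (xy ∷ l) with Linked⇒AllPairs-CNext ds l
  ... | ys ∷ yss = (xy ∷ All.map (λ yz odd → ≤-trans (yz odd) (s≤s x≥y)) ys) ∷ ys ∷ yss

  -- A part a before o has a + 1 ≥ o + 2k, beyond the forbidden range. A part after o within that
  -- range equals o, and `CNext o o` would require 2k ≤ 1.
  Linked⇒CCondition : 1 ≤ k → ∀ {p} → AllPairs _≥_ p → Linked CNext p → CCondition k p
  Linked⇒CCondition 1≤k ds l j i =
    All.map excluded (All-─ (AllPairs.zip (ds , Linked⇒AllPairs-CNext ds l)) i)
    where
    o = 2 * j + 1
    excluded : ∀ {a} → (a ≥ o × CNext a o) ⊎ (o ≥ a × CNext o a) →
               ¬ (o ≤ a × a ≤ 2 * j + 2 * k ∸ 1)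
    excluded {a} (inj₁ (_ , next)) (_ , a≤) =
      <⇒≱ (∸-monoʳ-< {2 * j + 2 * k} {1} {0} z<s
             (≤-trans 1≤k (≤-trans (m≤n*m k 2) (m≤n+m (2 * k) (2 * j)))))
          (≤-trans (s≤s⁻¹ (subst (_≤ suc a) (+1-swap (2 * j) (2 * k)) (next (2*+1-odd j)))) a≤)
    excluded {a} (inj₂ (o≥a , next)) (o≤a , _) with refl ← ≤-antisym o≤a o≥a =
      <⇒≱ (≤-trans (≤-reflexive (+-comm 2 o)) (+-monoʳ-≤ o (*-monoʳ-≤ 2 1≤k)))
          (next (2*+1-odd j))

  -- A fictitious first part x ≥ n + 2k restricts nothing, since every part y ≤ n satisfies y + 2k ≤
  -- x + 1.
  C₀≡tails : 1 ≤ k → ∀ x n → n + 2 * k ≤ x → C₀ k n ≡ tails CNext? x n n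
  C₀≡tails 1≤k x n n+2k≤x = length-filter-cong (CCondition? k) _ (partitions n) λ p∈ →
    let isPartition ds _ total = ∈-partitions⁻ p∈
    in mk⇔ (λ c → start total (CCondition⇒Linked ds c)) (Linked⇒CCondition 1≤k ds ∘ Linked.tail)
    where
    start : ∀ {p} → sum p ≡ n → Linked CNext p → Linked CNext (x ∷ p)
    start {[]}    _    l = [-]
    start {y ∷ p} refl l =
      (λ _ → ≤-trans (+-monoˡ-≤ (2 * k) (m≤m+n y (sum p))) (m≤n⇒m≤1+n n+2k≤x)) ∷ l

  -- The recurrence for C-partitions.

  CNext-cong : ∀ {x x′ y} → (Odd y → y + 2 * k ≤ suc x ⇔ y + 2 * k ≤ suc x′) →
               CNext x y ⇔ CNext x′ y
  CNext-cong h = mk⇔ (λ q odd → Equivalence.to (h odd) (q odd))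
                     (λ q odd → Equivalence.from (h odd) (q odd))

  -- The series e(a).
  evenTails : ℕ → Series
  evenTails a = tails CNext? (2 * a) (2 * a)

  module _ (2≤k : 2 ≤ k) where
    private
      both : ∀ {A B : Set} → A → B → A ⇔ B
      both a b = mk⇔ (λ _ → b) (λ _ → a)

      neither : ∀ {A B : Set} → ¬ A → ¬ B → A ⇔ B
      neither ¬a ¬b = mk⇔ (⊥-elim ∘ ¬a) (⊥-elim ∘ ¬b)

      too-big : ∀ {z a x} → 2 + 2 * suc a ≤ z → x ≤ 2 * suc a → ¬ z ≤ suc x
      too-big 2+≤z x≤ = <⇒≱ (≤-trans (s≤s (s≤s x≤)) 2+≤z)

      1+2b≤2a : ∀ {a} b → k + b ≡ suc a → 1 + 2 * b ≤ 2 * a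
      1+2b≤2a {a} b eq = ≤-trans (n≤1+n _) (≤-trans (≤-reflexive (sym (*-suc 2 b)))
        (*-monoʳ-≤ 2 (s≤s⁻¹ (subst (2 + b ≤_) eq (+-monoˡ-≤ b 2≤k)))))

    -- The odd part 2b + 1 cannot repeat. For smaller odd y the sum y + 2k is odd, so the bounds 2b
    -- + 2 and 2b + 1 on it are equivalent.
    evenTails-odd : ∀ b n → tails CNext? (1 + 2 * b) (1 + 2 * b) n ≡ evenTails b n
    evenTails-odd b n = trans (tails-suc-no CNext? self n)
      (tails-agree₀ CNext? (2 * b) n λ y _ _ → CNext-cong λ odd →
        mk⇔ (λ le → s≤s⁻¹ (≤∧≢⇒< le (not-even odd))) m≤n⇒m≤1+n)
      where
      self : ¬ CNext (1 + 2 * b) (1 + 2 * b)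
      self q = <⇒≱ (≤-trans (m≤m+n (3 + 2 * b) 2) (≤-trans (≤-reflexive (eq b))
        (+-monoʳ-≤ (1 + 2 * b) (*-monoʳ-≤ 2 2≤k)))) (q (1+2*-odd b))
        where
        eq : ∀ b → 3 + 2 * b + 2 ≡ 1 + 2 * b + 2 * 2
        eq = solve-∀
      not-even : ∀ {y} → Odd y → y + 2 * k ≢ 2 + 2 * b
      not-even odd eq = odd (∣m+n∣m⇒∣n
        (subst (2 ∣_) (trans (sym (trans eq (sym (*-suc 2 b)))) (+-comm _ (2 * k))) (2*-even (suc b)))
        (2*-even k))

    -- The even part 2a + 2 may follow itself, which gives the `σ` term; the odd part 2a + 1 after
    -- it would need 2k ≤ 2.
    evenTails-suc : ∀ a n → evenTails (suc a) n ≡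
      tails CNext? (2 * suc a) (2 * a) n + σ evenTails (suc a) n
    evenTails-suc a n rewrite *-suc 2 a = trans
      (tails-suc-yes CNext? (λ odd → contradiction (subst Even (*-suc 2 a) (2*-even (suc a))) odd) n)
      (cong (_+ shift (2 + 2 * a) (tails CNext? (2 + 2 * a) (2 + 2 * a)) n)
        (tails-suc-no CNext? no-next n))
      where
      no-next : ¬ CNext (2 + 2 * a) (1 + 2 * a)
      no-next q = <⇒≱ (≤-trans (m≤m+n (4 + 2 * a) 1) (≤-trans (≤-reflexive (eq a))
                        (+-monoʳ-≤ (1 + 2 * a) (*-monoʳ-≤ 2 2≤k))))
                      (q (1+2*-odd a))
        where
        eq : ∀ a → 4 + 2 * a + 1 ≡ 1 + 2 * a + 2 * 2
        eq = solve-∀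

    -- Replacing the predecessor 2a by 2a + 2 relaxes y + 2k ≤ 2a + 1 to y + 2k ≤ 2a + 3. The only
    -- odd y gained is 2b + 1 with b = a + 1 - k, present when k ≤ a + 1; by `evenTails-odd` it
    -- contributes q^(2b+1) e(b).
    evenTails-lag : ∀ a n → tails CNext? (2 * suc a) (2 * a) n ≡
      evenTails a n + Z 1 (X k (σ evenTails)) (suc a) n
    evenTails-lag a n with k ≤? suc a
    ... | no k≰1+a = trans
      (tails-agree₀ CNext? (2 * a) n λ y _ _ → CNext-cong λ _ →
        neither (too-big (big y) ≤-refl) (too-big (big y) (*-monoʳ-≤ 2 (n≤1+n a))))
      (sym (trans
        (cong (evenTails a n +_) (trans (Z-X 1 k (σ evenTails) (suc a) n) (shift-< _ (≰⇒> k≰1+a))))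
        (+-identityʳ _)))
      where
      big : ∀ y → 2 + 2 * suc a ≤ y + 2 * k
      big y = ≤-trans (≤-reflexive (sym (*-suc 2 (suc a))))
        (≤-trans (*-monoʳ-≤ 2 (≰⇒> k≰1+a)) (m≤n+m (2 * k) y))
    ... | yes k≤1+a with b , k+b≡1+a ← m≤n⇒∃[o]m+o≡n k≤1+a
      -- As k ≥ 2, the gained part 2b + 1 is at most 2a. The range up to 2a splits into parts below
      -- it, itself, and the d parts above it, where neither predecessor admits an odd part.
      with d , 1+2b+d≡2a ← m≤n⇒∃[o]m+o≡n (1+2b≤2a b k+b≡1+a) =
      subst (λ m → tails CNext? (2 * suc a) m n ≡ tails CNext? (2 * a) m n + c) 1+2b+d≡2a
        (tails-agree CNext? (1 + 2 * b) d n upper middle)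
      where
      c = Z 1 (X k (σ evenTails)) (suc a) n

      2b+2k≡ : 2 * b + 2 * k ≡ 2 * suc a
      2b+2k≡ = trans (sym (*-distribˡ-+ 2 b k)) (cong (2 *_) (trans (+-comm b k) k+b≡1+a))

      c≡ : c ≡ shift (1 + 2 * b) (tails CNext? (1 + 2 * b) (1 + 2 * b)) n
      c≡ = begin
        Z 1 (X k (σ evenTails)) (suc a) n
          ≡⟨ Z-X 1 k (σ evenTails) (suc a) n ⟩
        X k (Z 1 (σ evenTails)) (suc a) n
          ≡⟨ cong (λ j → X k (Z 1 (σ evenTails)) j n) k+b≡1+a ⟨
        X k (Z 1 (σ evenTails)) (k + b) n
          ≡⟨ shift-≥ k _ b ⟩
        Z 1 (σ evenTails) b n
          ≡⟨ shift-shift 1 (2 * b) _ n ⟩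
        shift (1 + 2 * b) (evenTails b) n
          ≡⟨ shift-cong (1 + 2 * b) n (λ m _ → evenTails-odd b m) ⟨
        shift (1 + 2 * b) (tails CNext? (1 + 2 * b) (1 + 2 * b)) n ∎

      lower : ∀ y → 1 ≤ y → y ≤ 2 * b → CNext (2 * suc a) y ⇔ CNext (2 * a) y
      lower y _ y≤2b = CNext-cong λ odd →
        let y<2b = ≤∧≢⇒< y≤2b λ { refl → odd (2*-even b) }
            y+2k≤ = s≤s⁻¹ (subst (suc (y + 2 * k) ≤_) (trans 2b+2k≡ (*-suc 2 a))
              (+-monoˡ-≤ (2 * k) y<2b))
        in both (≤-trans y+2k≤ (s≤s (*-monoʳ-≤ 2 (n≤1+n a)))) y+2k≤

      middle : tails CNext? (2 * suc a) (1 + 2 * b) n ≡ tails CNext? (2 * a) (1 + 2 * b) n + c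
      middle = begin
        tails CNext? (2 * suc a) (1 + 2 * b) n
          ≡⟨ tails-suc-yes CNext? (λ _ → ≤-reflexive (cong suc 2b+2k≡)) n ⟩
        tails CNext? (2 * suc a) (2 * b) n + shift (1 + 2 * b) (tails CNext? (1 + 2 * b) (1 + 2 * b)) n
          ≡⟨ cong₂ _+_ (tails-agree₀ CNext? (2 * b) n lower) (sym c≡) ⟩
        tails CNext? (2 * a) (2 * b) n + c
          ≡⟨ cong (_+ c) (tails-suc-no CNext? no-next n) ⟨
        tails CNext? (2 * a) (1 + 2 * b) n + c ∎
        where
        no-next : ¬ CNext (2 * a) (1 + 2 * b)
        no-next q = <⇒≱ (n≤1+n (suc (suc (2 * a))))
          (subst (_≤ suc (2 * a)) (cong suc (trans 2b+2k≡ (*-suc 2 a))) (q (1+2*-odd b)))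

      upper : ∀ y → 1 + 2 * b < y → y ≤ 1 + 2 * b + d → CNext (2 * suc a) y ⇔ CNext (2 * a) y
      upper y 1+2b<y _ = CNext-cong λ _ →
        neither (too-big big ≤-refl) (too-big big (*-monoʳ-≤ 2 (n≤1+n a)))
        where
        big : 2 + 2 * suc a ≤ y + 2 * k
        big = ≤-trans (≤-reflexive (cong (2 +_) (sym 2b+2k≡))) (+-monoˡ-≤ (2 * k) 1+2b<y)

    evenTails-recurrence : ∀ N → Recurrence N k 1 evenTails
    evenTails-recurrence N zero n _ = sym (begin
      evenTails 0 n + 0 + Z 1 (X k (σ evenTails)) 0 n
        ≡⟨ cong (evenTails 0 n + 0 +_)
             (trans (Z-X 1 k (σ evenTails) 0 n) (shift-< _ (≤-trans (s≤s z≤n) 2≤k))) ⟩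
      evenTails 0 n + 0 + 0
        ≡⟨ trans (+-identityʳ _) (+-identityʳ _) ⟩
      evenTails 0 n ∎)
    evenTails-recurrence N (suc a) n _ = begin
      evenTails (suc a) n
        ≡⟨ evenTails-suc a n ⟩
      tails CNext? (2 * suc a) (2 * a) n + σ evenTails (suc a) n
        ≡⟨ cong (_+ σ evenTails (suc a) n) (evenTails-lag a n) ⟩
      evenTails a n + Z 1 (X k (σ evenTails)) (suc a) n + σ evenTails (suc a) n
        ≡⟨ rotate (evenTails a n) _ _ ⟩
      σ evenTails (suc a) n + evenTails a n + Z 1 (X k (σ evenTails)) (suc a) n ∎
      where
      rotate : ∀ a b c → a + b + c ≡ c + a + b
      rotate = solve-∀

-- Partitions with parts in a prescribed set.

linear-step : ∀ {N a o} {u u′ v v′ w w′ : Series} → 1 ≤ a →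
  u′ ≈[ N ] (λ n → u n + shift a u′ n) →
  v′ ≈[ N ] (λ n → v n + shift a v′ n) →
  w′ ≈[ N ] (λ n → w n + shift a w′ n) →
  u ≈[ N ] (λ n → v n + shift o w n) → u′ ≈[ N ] (λ n → v′ n + shift o w′ n)
linear-step {N} {a} {o} {u} {u′} {v} {v′} {w} {w′} 1≤a u′≈ v′≈ w′≈ u≈ =
  -- The primed series are u, v, w divided by 1 - q^a; both sides of the relation solve f = u + q^a
  -- f.
  geometric-unique a {h = u} {h′ = u} 1≤a (λ _ _ → refl) u′≈ λ n n≤N → begin
    v′ n + shift o w′ n
      ≡⟨ cong₂ _+_ (v′≈ n n≤N) (trans (shift-cong-≈ o w′≈ n n≤N) (shift-distrib-+ o _ _ n)) ⟩
    (v n + shift a v′ n) + (shift o w n + shift o (shift a w′) n)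
      ≡⟨ interchange (v n) _ _ _ ⟩
    (v n + shift o w n) + (shift a v′ n + shift o (shift a w′) n)
      ≡⟨ cong₂ _+_ (sym (u≈ n n≤N)) (cong (shift a v′ n +_) (shift-comm o a w′ n)) ⟩
    u n + (shift a v′ n + shift a (shift o w′) n)
      ≡⟨ cong (u n +_) (shift-distrib-+ a _ _ n) ⟨
    u n + shift a (λ m → v′ m + shift o w′ m) n ∎
  where
  interchange : ∀ a b c d → (a + b) + (c + d) ≡ (a + c) + (b + d)
  interchange = solve-∀

module _ {S : Pred ℕ 0ℓ} (S? : Decidable S) where

  -- The preceding part 0 is a dummy, ignored by the relation.
  parts : ℕ → Series
  parts m = tails (λ _ → S?) 0 m

  parts-suc-no : ∀ {m} → ¬ S (suc m) → ∀ n → parts (suc m) n ≡ parts m n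
  parts-suc-no = tails-suc-no (λ _ → S?)

  parts-suc-yes : ∀ {m} → S (suc m) → ∀ n →
    parts (suc m) n ≡ parts m n + shift (suc m) (parts (suc m)) n
  parts-suc-yes {m} s n = trans (tails-suc-yes (λ _ → S?) s n) (cong (parts m n +_)
    (shift-cong (suc m) n λ j _ → tails-agree₀ (λ _ → S?) (suc m) j λ _ _ _ → mk⇔ id id))

  parts-cutoff : ∀ {N m m′} → N ≤ m → N ≤ m′ → parts m ≈[ N ] parts m′
  parts-cutoff {N} N≤m N≤m′ n n≤N = trans (cut N≤m) (sym (cut N≤m′))
    where
    cut : ∀ {m} → N ≤ m → parts m n ≡ parts N n
    cut N≤m with d , refl ← m≤n⇒∃[o]m+o≡n N≤m = tails-stable (λ _ → S?) 0 N d n n≤N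

module _ {S T : Pred ℕ 0ℓ} (S? : Decidable S) (T? : Decidable T) where

  parts-agree : ∀ m → (∀ y → 1 ≤ y → y ≤ m → S y ⇔ T y) → ∀ n → parts S? m n ≡ parts T? m n
  parts-agree zero    agr n = trans (tails-zero (λ _ → S?) 0 n) (sym (tails-zero (λ _ → T?) 0 n))
  parts-agree (suc m) agr n
    with S? (suc m) | T? (suc m) | parts-agree m (λ y 1≤y y≤m → agr y 1≤y (m≤n⇒m≤1+n y≤m))
  ... | no ¬s | no ¬t | ih = trans (parts-suc-no S? ¬s n) (trans (ih n) (sym (parts-suc-no T? ¬t n)))
  ... | yes s | no ¬t | _  = contradiction (Equivalence.to (agr _ (s≤s z≤n) ≤-refl) s) ¬t
  ... | no ¬s | yes t | _  = contradiction (Equivalence.from (agr _ (s≤s z≤n) ≤-refl) t) ¬s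
  ... | yes s | yes t | ih = geometric-unique (suc m) (s≤s z≤n) (λ j _ → ih j)
    (λ j _ → parts-suc-yes S? s j) (λ j _ → parts-suc-yes T? t j) n ≤-refl

module _ {S T U : Pred ℕ 0ℓ} (S? : Decidable S) (T? : Decidable T) (U? : Decidable U) where

  -- Each further part lies in all three sets or in none, so the three series gain the same factor
  -- 1/(1 - q^y) or stay unchanged.
  parts-relation : ∀ o m d → (∀ y → m < y → y ≤ m + d → S y ⇔ T y × S y ⇔ U y) →
    (∀ n → parts S? m n ≡ parts T? m n + shift o (parts U? m) n) →
    ∀ n → parts S? (m + d) n ≡ parts T? (m + d) n + shift o (parts U? (m + d)) n
  parts-relation o m zero    agr h rewrite +-identityʳ m = h
  parts-relation o m (suc d) agr h rewrite +-suc m d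
    with S? (suc (m + d)) | agr (suc (m + d)) (s≤s (m≤m+n m d)) ≤-refl
       | parts-relation o m d (λ y m<y y≤ → agr y m<y (m≤n⇒m≤1+n y≤)) h
  ... | no ¬s | s⇔t , s⇔u | ih = λ n → trans (parts-suc-no S? ¬s n) (trans (ih n) (sym (cong₂ _+_
    (parts-suc-no T? (¬s ∘ Equivalence.from s⇔t) n)
    (shift-cong o n λ j _ → parts-suc-no U? (¬s ∘ Equivalence.from s⇔u) j))))
  ... | yes s | s⇔t , s⇔u | ih = λ n → linear-step
    {o = o} {v = parts T? (m + d)} {w = parts U? (m + d)}
    (s≤s z≤n)
    (λ j _ → parts-suc-yes S? s j)
    (λ j _ → parts-suc-yes T? (Equivalence.to s⇔t s) j)
    (λ j _ → parts-suc-yes U? (Equivalence.to s⇔u s) j)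
    (λ j _ → ih j) n (≤-refl {n})

-- Glaisher's exchange 1/(1 − q^o) = (1 + q^o)/(1 − q^2o).
parts-exchange : ∀ {S T : Pred ℕ 0ℓ} (S? : Decidable S) (T? : Decidable T) o → 1 ≤ o →
  S o → ¬ T o → ¬ S (o + o) → T (o + o) →
  (∀ y → 1 ≤ y → y ≢ o → y ≢ o + o → S y ⇔ T y) →
  ∀ m → o + o ≤ m → ∀ n → parts S? m n ≡ parts T? m n + shift o (parts T? m) n
parts-exchange {S} {T} S? T? (suc o) _ So ¬To ¬S2o T2o agr m 2o≤m
  with d , refl ← m≤n⇒∃[o]m+o≡n 2o≤m =
  parts-relation S? T? T? (suc o) (suc o + suc o) d
    (λ y 2o<y _ →
      let o<y = <-≤-trans (m<m+n (suc o) z<s) (<⇒≤ 2o<y)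
          s⇔t = agr y (≤-trans (s≤s z≤n) 2o<y) (>⇒≢ o<y) (>⇒≢ 2o<y)
      in s⇔t , s⇔t)
    at-2o
  where
  id⇔ : ∀ {A : Set} → A ⇔ A
  id⇔ = mk⇔ id id

  -- Below o the two sets agree; at o only S gains a factor 1/(1 - q^o).
  at-o : ∀ n → parts S? (suc o) n ≡ parts T? (suc o) n + shift (suc o) (parts S? (suc o)) n
  at-o n = trans (parts-suc-yes S? So n) (cong (_+ _) (trans
    (parts-agree S? T? o (λ y 1≤y y≤o →
      agr y 1≤y (<⇒≢ (s≤s y≤o)) (<⇒≢ (<-≤-trans (s≤s y≤o) (m≤m+n (suc o) (suc o))))) n)
    (sym (parts-suc-no T? ¬To n))))

  below-2o : ∀ n →
    parts S? (suc o + o) n ≡ parts T? (suc o + o) n + shift (suc o) (parts S? (suc o + o)) n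
  below-2o = parts-relation S? T? S? (suc o) (suc o) o
    (λ y o<y y≤ → agr y (≤-trans (s≤s z≤n) o<y) (>⇒≢ o<y)
        (<⇒≢ (<-≤-trans (s≤s y≤) (≤-reflexive (sym (+-suc (suc o) o))))) , id⇔)
    at-o

  -- Both sides solve f = V + q^o f: the left by `below-2o`, the right because W = V + q^2o W gives
  -- (1 + q^o) W = V + q^o (1 + q^o) W.
  at-2o : ∀ n → parts S? (suc o + suc o) n ≡
    parts T? (suc o + suc o) n + shift (suc o) (parts T? (suc o + suc o)) n
  at-2o n = geometric-unique (suc o) (s≤s z≤n) (λ _ _ → refl)
    (λ j _ → begin
      parts S? 2o j                          ≡⟨ S-drop j ⟩
      parts S? (suc o + o) j                 ≡⟨ below-2o j ⟩
      V j + shift (suc o) (parts S? (suc o + o)) j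
        ≡⟨ cong (V j +_) (shift-cong (suc o) j λ i _ → S-drop i) ⟨
      V j + shift (suc o) (parts S? 2o) j    ∎)
    (λ j _ → begin
      W j + shift (suc o) W j
        ≡⟨ cong (_+ shift (suc o) W j) (T-add j) ⟩
      V j + shift 2o W j + shift (suc o) W j
        ≡⟨ rotate (V j) _ _ ⟩
      V j + (shift (suc o) W j + shift 2o W j)
        ≡⟨ cong (λ z → V j + (shift (suc o) W j + z)) (shift-shift (suc o) (suc o) W j) ⟨
      V j + (shift (suc o) W j + shift (suc o) (shift (suc o) W) j)
        ≡⟨ cong (V j +_) (shift-distrib-+ (suc o) _ _ j) ⟨
      V j + shift (suc o) (λ i → W i + shift (suc o) W i) j ∎)
    n ≤-refl
    where
    2o = suc o + suc o
    V W : Series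
    V = parts T? (suc o + o)
    W = parts T? 2o
    rotate : ∀ a b c → a + b + c ≡ a + (c + b)
    rotate = solve-∀
    S-drop : ∀ j → parts S? 2o j ≡ parts S? (suc o + o) j
    S-drop j rewrite +-suc o o = parts-suc-no S? ¬S2o j
    T-add : ∀ j → W j ≡ V j + shift 2o W j
    T-add j rewrite +-suc o o = parts-suc-yes T? T2o j

-- The parts of B-partitions modulo 4k.

≡-mod⇒+ : ∀ {a r m} → r ≤ a → a ≡ r [mod m ] → ∃ λ q → a ≡ r + q * m
≡-mod⇒+ {a} {r} {m} r≤a m∣ with c , refl ← m≤n⇒∃[o]m+o≡n r≤a
  with divides q c≡ ← subst (m ∣_) (trans (∣-∣-comm (r + c) r) (∣m-m+n∣≡n r c)) m∣ = q , cong (r +_) c≡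

+⇒≡-mod : ∀ r q m → (r + q * m) ≡ r [mod m ]
+⇒≡-mod r q m = subst (m ∣_) (sym (trans (∣-∣-comm (r + q * m) r) (∣m-m+n∣≡n r (q * m)))) (n∣m*n q)

module _ (k : ℕ) (2≤k : 2 ≤ k) where

  BPart? : Decidable (BPart k)
  BPart? a = ((2 ∣? a) ×-dec ¬? (a ≡? 2 [mod 4 * k ]))
    ⊎-dec (¬? (2 ∣? a) ×-dec ((a ≡? 1 [mod 4 * k ]) ⊎-dec (a ≡? 2 * k + 1 [mod 4 * k ])))

  private
    1≤k : 1 ≤ k
    1≤k = ≤-trans (s≤s z≤n) 2≤k

  -- The odd parts allowed in B-partitions: even i gives residue 1, odd i residue 2k + 1 modulo 4k.
  odd-part : ℕ → ℕ
  odd-part i = 1 + 2 * (k * i)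

  odd-part-odd : ∀ i → Odd (odd-part i)
  odd-part-odd i = 1+2*-odd (k * i)

  odd-part-suc : ∀ i → odd-part (suc i) ≡ odd-part i + 2 * k
  odd-part-suc i = eq k i
    where
    eq : ∀ k i → 1 + 2 * (k * suc i) ≡ 1 + 2 * (k * i) + 2 * k
    eq = solve-∀

  odd-part-mono : ∀ {i j} → i ≤ j → odd-part i ≤ odd-part j
  odd-part-mono i≤j = s≤s (*-monoʳ-≤ 2 (*-monoʳ-≤ k i≤j))

  odd-part-2* : ∀ j → 1 + j * (4 * k) ≡ odd-part (2 * j)
  odd-part-2* j = eq k j
    where
    eq : ∀ k j → 1 + j * (4 * k) ≡ 1 + 2 * (k * (2 * j))
    eq = solve-∀

  odd-part-2*+1 : ∀ j → 2 * k + 1 + j * (4 * k) ≡ odd-part (2 * j + 1)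
  odd-part-2*+1 j = eq k j
    where
    eq : ∀ k j → 2 * k + 1 + j * (4 * k) ≡ 1 + 2 * (k * (2 * j + 1))
    eq = solve-∀

  odd-part-BPart : ∀ i → BPart k (odd-part i)
  odd-part-BPart i = inj₂ (odd-part-odd i , residue (even∨odd i))
    where
    residue : (∃ λ j → i ≡ 2 * j) ⊎ (∃ λ j → i ≡ 2 * j + 1) →
      odd-part i ≡ 1 [mod 4 * k ] ⊎ odd-part i ≡ 2 * k + 1 [mod 4 * k ]
    residue (inj₁ (j , refl)) = inj₁ (subst (_≡ 1 [mod 4 * k ]) (odd-part-2* j) (+⇒≡-mod 1 j (4 * k)))
    residue (inj₂ (j , refl)) =
      inj₂ (subst (_≡ 2 * k + 1 [mod 4 * k ]) (odd-part-2*+1 j) (+⇒≡-mod (2 * k + 1) j (4 * k)))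

  odd-BPart⇒odd-part : ∀ {y} → Odd y → BPart k y → ∃ λ i → y ≡ odd-part i
  odd-BPart⇒odd-part odd (inj₁ (even , _)) = contradiction even odd
  odd-BPart⇒odd-part {zero}  odd (inj₂ _) = contradiction (2*-even 0) odd
  odd-BPart⇒odd-part {suc y} odd (inj₂ (_ , inj₁ ≡1))
    with q , eq ← ≡-mod⇒+ (s≤s z≤n) ≡1 = 2 * q , trans eq (odd-part-2* q)
  odd-BPart⇒odd-part {suc y} odd (inj₂ (_ , inj₂ ≡2k+1)) with 2 * k + 1 ≤? suc y
  ... | yes 2k+1≤ with q , eq ← ≡-mod⇒+ 2k+1≤ ≡2k+1 = 2 * q + 1 , trans eq (odd-part-2*+1 q)
  -- Congruence is stated with the absolute difference, so parts below 2k + 1 need excluding: the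
  -- difference is positive and less than 4k.
  ... | no 2k+1≰ = contradiction (∣⇒≤ {{>-nonZero gap>0}} ≡2k+1) (<⇒≱ gap<4k)
    where
    gap≡ : ∣ suc y - (2 * k + 1) ∣ ≡ 2 * k + 1 ∸ suc y
    gap≡ = m≤n⇒∣m-n∣≡n∸m (<⇒≤ (≰⇒> 2k+1≰))
    gap>0 : 0 < ∣ suc y - (2 * k + 1) ∣
    gap>0 = subst (0 <_) (sym gap≡) (m<n⇒0<n∸m (≰⇒> 2k+1≰))
    gap<4k : ∣ suc y - (2 * k + 1) ∣ < 4 * k
    gap<4k = ≤-<-trans
      (≤-trans (≤-reflexive (trans gap≡ (cong (_∸ suc y) (+-comm (2 * k) 1)))) (m∸n≤m (2 * k) y))
      (*-monoˡ-< k {{>-nonZero 1≤k}} {2} {4} (s≤s (s≤s (s≤s z≤n))))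

  -- The excluded even parts, those congruent to 2 modulo 4k, are the doubles of the allowed odd
  -- parts. This pairing is what Glaisher's exchange acts on.
  twice-odd-part : ∀ i → 2 + i * (4 * k) ≡ odd-part i + odd-part i
  twice-odd-part i = eq k i
    where
    eq : ∀ k i → 2 + i * (4 * k) ≡ 1 + 2 * (k * i) + (1 + 2 * (k * i))
    eq = solve-∀

  a+a-even : ∀ a → Even (a + a)
  a+a-even a = subst (λ z → Even (a + z)) (+-identityʳ a) (2*-even a)

  twice-odd-part-¬BPart : ∀ i → ¬ BPart k (odd-part i + odd-part i)
  twice-odd-part-¬BPart i (inj₁ (_ , ≢2)) =
    ≢2 (subst (_≡ 2 [mod 4 * k ]) (twice-odd-part i) (+⇒≡-mod 2 i (4 * k)))
  twice-odd-part-¬BPart i (inj₂ (odd , _)) = odd (a+a-even (odd-part i))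

  even-¬BPart⇒twice : ∀ {y} → 1 ≤ y → Even y → ¬ BPart k y → ∃ λ i → y ≡ odd-part i + odd-part i
  even-¬BPart⇒twice {suc zero}    _ 2∣1  _ with () ← ∣1⇒≡1 2∣1
  even-¬BPart⇒twice {suc (suc y)} _ even ¬B with suc (suc y) ≡? 2 [mod 4 * k ]
  ... | no ≢2 = contradiction (inj₁ (even , ≢2)) ¬B
  ... | yes ≡2 with q , eq ← ≡-mod⇒+ (s≤s (s≤s z≤n)) ≡2 = q , trans eq (twice-odd-part q)

  -- From B-partitions to even parts, one exchange at a time.

  -- Interpolates between BPart k (s = 1) and Even (s → ∞).
  Mixed : ℕ → Pred ℕ 0ℓ
  Mixed s y = (Even y × (BPart k y ⊎ y < s + s)) ⊎ (Odd y × (BPart k y × s ≤ y))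

  Mixed? : ∀ s → Decidable (Mixed s)
  Mixed? s y = ((2 ∣? y) ×-dec (BPart? y ⊎-dec (y <? s + s)))
    ⊎-dec (¬? (2 ∣? y) ×-dec (BPart? y ×-dec (s ≤? y)))

  Mixed-one : ∀ {y} → 1 ≤ y → Mixed 1 y ⇔ BPart k y
  Mixed-one {y} 1≤y = mk⇔ to from
    where
    to : Mixed 1 y → BPart k y
    to (inj₁ (_ , inj₁ b))      = b
    to (inj₁ (even , inj₂ y<2)) with refl ← ≤-antisym 1≤y (s≤s⁻¹ y<2) with () ← ∣1⇒≡1 even
    to (inj₂ (_ , b , _))       = b
    from : BPart k y → Mixed 1 y
    from b with 2 ∣? y
    ... | yes even = inj₁ (even , inj₁ b)
    ... | no odd   = inj₂ (odd , b , 1≤y)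

  Mixed-even : ∀ {s y} → y < s → Mixed s y ⇔ Even y
  Mixed-even {s} y<s = mk⇔
    (λ { (inj₁ (even , _)) → even ; (inj₂ (_ , _ , s≤y)) → contradiction s≤y (<⇒≱ y<s) })
    (λ even → inj₁ (even , inj₂ (<-≤-trans y<s (m≤m+n s s))))

  -- No allowed odd part lies strictly between consecutive thresholds. Raising the threshold thus
  -- removes only o = `odd-part i` and adds only 2o.
  Mixed-step : ∀ i y → 1 ≤ y → y ≢ odd-part i → y ≢ odd-part i + odd-part i →
    Mixed (odd-part i) y ⇔ Mixed (odd-part (suc i)) y
  Mixed-step i y 1≤y y≢o y≢2o = mk⇔ to from
    where
    o≤o′ = odd-part-mono (n≤1+n i)

    to : Mixed (odd-part i) y → Mixed (odd-part (suc i)) y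
    to (inj₁ (even , inj₁ b))    = inj₁ (even , inj₁ b)
    to (inj₁ (even , inj₂ y<2o)) = inj₁ (even , inj₂ (<-≤-trans y<2o (+-mono-≤ o≤o′ o≤o′)))
    to (inj₂ (odd , b , o≤y)) with q , refl ← odd-BPart⇒odd-part odd b with <-cmp i q
    ... | tri< i<q _ _  = inj₂ (odd , b , odd-part-mono i<q)
    ... | tri≈ _ refl _ = contradiction refl y≢o
    ... | tri> _ _ q<i  = contradiction (≤-antisym (odd-part-mono (<⇒≤ q<i)) o≤y) y≢o

    from : Mixed (odd-part (suc i)) y → Mixed (odd-part i) y
    from (inj₁ (even , inj₁ b)) = inj₁ (even , inj₁ b)
    from (inj₁ (even , inj₂ y<2o′)) with BPart? y
    ... | yes b = inj₁ (even , inj₁ b)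
    ... | no ¬b with q , refl ← even-¬BPart⇒twice 1≤y even ¬b with <-cmp i q
    ... | tri< i<q _ _  = contradiction (+-mono-≤ (odd-part-mono i<q) (odd-part-mono i<q)) (<⇒≱ y<2o′)
    ... | tri≈ _ refl _ = contradiction refl y≢2o
    ... | tri> _ _ q<i  = inj₁ (even , inj₂ (≤∧≢⇒<
      (+-mono-≤ (odd-part-mono (<⇒≤ q<i)) (odd-part-mono (<⇒≤ q<i))) y≢2o))
    from (inj₂ (odd , b , o′≤y)) = inj₂ (odd , b , ≤-trans o≤o′ o′≤y)

  Mixed-exchange : ∀ i m → odd-part i + odd-part i ≤ m → ∀ n → parts (Mixed? (odd-part i)) m n ≡
    parts (Mixed? (odd-part (suc i))) m n + shift (odd-part i) (parts (Mixed? (odd-part (suc i))) m) n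
  Mixed-exchange i = parts-exchange (Mixed? o) (Mixed? o′) o (s≤s z≤n)
    (inj₂ (odd-part-odd i , odd-part-BPart i , ≤-refl))
    (λ { (inj₁ (even , _)) → odd-part-odd i even ; (inj₂ (_ , _ , o′≤o)) → <⇒≱ o<o′ o′≤o })
    (λ { (inj₁ (_ , inj₁ b)) → twice-odd-part-¬BPart i b
       ; (inj₁ (_ , inj₂ 2o<2o)) → <-irrefl refl 2o<2o
       ; (inj₂ (odd , _)) → odd (a+a-even o) })
    (inj₁ (a+a-even o , inj₂ (+-mono-< o<o′ o<o′)))
    (Mixed-step i)
    where
    o  = odd-part i
    o′ = odd-part (suc i)
    o<o′ : o < o′
    o<o′ = subst (o <_) (sym (odd-part-suc i)) (m<m+n o (≤-trans 1≤k (m≤n*m k 2)))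

  B₀≡parts : ∀ n → B₀ k n ≡ parts (Mixed? 1) n n
  B₀≡parts n = length-filter-cong (BCondition? k) _ (partitions n) λ p∈ →
    let isPartition _ pos _ = ∈-partitions⁻ {n} p∈ in mk⇔ (to pos) (from pos)
    where
    to : ∀ {x p} → All (1 ≤_) p → All (BPart k) p → Linked (λ _ → Mixed 1) (x ∷ p)
    to []       []       = [-]
    to (pos ∷ ps) (b ∷ bs) = Equivalence.from (Mixed-one pos) b ∷ to ps bs
    from : ∀ {x p} → All (1 ≤_) p → Linked (λ _ → Mixed 1) (x ∷ p) → All (BPart k) p
    from []         [-]     = []
    from (pos ∷ ps) (m ∷ l) = Equivalence.to (Mixed-one pos) m ∷ from ps l

  -- The product of twists and its limit.

  even-parts : ℕ → Series
  even-parts a = parts (2 ∣?_) (2 * a)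

  -- The finite form of s → ∞: for s > N the q^s term vanishes modulo q^(N+1).
  even-parts-recurrence : ∀ {N s} → N < s → Recurrence N k s even-parts
  even-parts-recurrence {N} {s} N<s a n n≤N = trans (drop-Z a)
    (sym (trans (cong (σ even-parts a n + X 1 even-parts a n +_) (shift-< _ (≤-<-trans n≤N N<s)))
      (+-identityʳ _)))
    where
    drop-Z : ∀ a → even-parts a n ≡ σ even-parts a n + X 1 even-parts a n
    drop-Z zero    = sym (+-identityʳ _)
    drop-Z (suc a) rewrite *-suc 2 a = trans
      (parts-suc-yes (2 ∣?_) (subst Even (*-suc 2 a) (2*-even (suc a))) n)
      (trans (cong (_+ shift (2 + 2 * a) (parts (2 ∣?_) (2 + 2 * a)) n)
          (parts-suc-no (2 ∣?_) (1+2*-odd a) n))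
        (+-comm (even-parts a n) _))

  -- The product of 1 + q^(2kj+1) x^k over i ≤ j < i + t, times the bivariate series of
  -- `even-parts`.
  tower : (t i : ℕ) → ℕ → Series
  tower zero    i = even-parts
  tower (suc t) i = twist k (odd-part i) (tower t (suc i))

  -- Each twist lowers s by 2k, from a value above N down to `odd-part i`.
  tower-recurrence : ∀ {N} t i → N < odd-part (i + t) → Recurrence N k (odd-part i) (tower t i)
  tower-recurrence {N} zero    i N< =
    even-parts-recurrence (subst (λ j → N < odd-part j) (+-identityʳ i) N<)
  tower-recurrence {N} (suc t) i N< =
    recurrence-twist {k = k} {s = odd-part i} (subst (λ s → Recurrence N k s (tower t (suc i)))
    (odd-part-suc i) (tower-recurrence t (suc i) (subst (λ j → N < odd-part j) (+-suc i t) N<)))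

  tower-zero : ∀ t i n → tower t i 0 n ≡ one n
  tower-zero zero    i n = tails-zero (λ _ → 2 ∣?_) 0 n
  tower-zero (suc t) i n = trans (cong₂ _+_ (tower-zero t (suc i) n)
    (trans (Z-X (odd-part i) k (tower t (suc i)) 0 n) (shift-< _ 1≤k))) (+-identityʳ _)

  -- For large a the series at a and a - k agree modulo q^(N+1), so a twist acts as multiplication
  -- by 1 + q^o and undoes one exchange. The bound N + t k ≤ a survives t steps of size k; the bound
  -- on m leaves room for every double 2o.
  tower-limit : ∀ {N m} t i a → N < odd-part (i + t) → N ≤ m →
    odd-part (i + t) + odd-part (i + t) ≤ m →
    N + t * k ≤ a → tower t i a ≈[ N ] parts (Mixed? (odd-part i)) m
  tower-limit {N} {m} zero i a N< N≤m _ N≤a n n≤N = begin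
    parts (2 ∣?_) (2 * a) n
      ≡⟨ parts-cutoff (2 ∣?_) (≤-trans (≤-trans (m≤m+n N 0) N≤a) (m≤n*m a 2)) ≤-refl n n≤N ⟩
    parts (2 ∣?_) N n
      ≡⟨ parts-agree (Mixed? (odd-part i)) (2 ∣?_) N (λ y _ y≤N → Mixed-even (≤-<-trans y≤N
           (subst (λ j → N < odd-part j) (+-identityʳ i) N<))) n ⟨
    parts (Mixed? (odd-part i)) N n
      ≡⟨ parts-cutoff (Mixed? (odd-part i)) ≤-refl N≤m n n≤N ⟩
    parts (Mixed? (odd-part i)) m n ∎
  tower-limit {N} {m} (suc t) i a N< N≤m 2o≤m N+tk≤a n n≤N
    with b , refl ← m≤n⇒∃[o]m+o≡n (≤-trans (≤-trans (m≤m+n k (t * k)) (m≤n+m _ N)) N+tk≤a) = begin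
    tower t (suc i) (k + b) n + Z o (X k (tower t (suc i))) (k + b) n
      ≡⟨ cong₂ _+_ (ih (k + b) (≤-trans N+tk≤b (m≤n+m b k)) n n≤N)
           (shift-cong-≈ o (λ j j≤N → trans (shift-≥ k _ b) (ih b N+tk≤b j j≤N)) n n≤N) ⟩
    parts (Mixed? (odd-part (suc i))) m n + shift o (parts (Mixed? (odd-part (suc i))) m) n
      ≡⟨ Mixed-exchange i m (≤-trans (+-mono-≤ o≤ o≤) 2o≤m) n ⟨
    parts (Mixed? o) m n ∎
    where
    o = odd-part i
    o≤ : o ≤ odd-part (i + suc t)
    o≤ = odd-part-mono (m≤m+n i (suc t))
    swap : ∀ N k c → N + (k + c) ≡ k + (N + c)
    swap = solve-∀
    N+tk≤b : N + t * k ≤ b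
    N+tk≤b = +-cancelˡ-≤ k _ _ (subst (_≤ k + b) (swap N k (t * k)) N+tk≤a)
    ih : ∀ a → N + t * k ≤ a → tower t (suc i) a ≈[ N ] parts (Mixed? (odd-part (suc i))) m
    ih a N+tk≤ = tower-limit t (suc i) a (subst (λ j → N < odd-part j) (+-suc i t) N<) N≤m
      (subst (λ j → odd-part j + odd-part j ≤ m) (+-suc i t) 2o≤m) N+tk≤

theorem3 : ∀ (k : ℕ) → 2 ≤ k → ∀ (n : ℕ) → B₀ k n ≡ C₀ k n
theorem3 k 2≤k n = begin
  B₀ k n                              ≡⟨ B₀≡parts k 2≤k n ⟩
  parts (M? 1) n n                    ≡⟨ parts-cutoff (M? 1) ≤-refl n≤m n ≤-refl ⟩
  parts (M? 1) m n                    ≡⟨ cong (λ s → parts (M? s) m n) one≡ ⟩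
  parts (M? (o 0)) m n                ≡⟨ tower-limit k 2≤k n 0 a n<o n≤m ≤-refl (m≤n+m _ k) n ≤-refl ⟨
  T a n                               ≡⟨ T≈ n ≤-refl ⟩
  evenTails k a n                     ≡⟨ cong (λ j → tails (CNext? k) (2 * a) j n) n+d≡ ⟨
  tails (CNext? k) (2 * a) (n + d) n  ≡⟨ tails-stable (CNext? k) (2 * a) n d n ≤-refl ⟩
  tails (CNext? k) (2 * a) n n        ≡⟨ C₀≡tails k 1≤k (2 * a) n n+2k≤2a ⟨
  C₀ k n                              ∎
  where
  o  = odd-part k 2≤k
  M? = Mixed? k 2≤k
  -- n factors suffice, since the next exponent 2kn + 1 exceeds n.
  T  = tower k 2≤k n 0
  -- The limit needs a ≥ n + n k; the extra k ensures n + 2k ≤ 2a, so that the part 2a restricts no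
  -- partition of n.
  a = k + (n + n * k)
  m = o n + o n
  1≤k : 1 ≤ k
  1≤k = ≤-trans (s≤s z≤n) 2≤k
  one≡ : 1 ≡ o 0
  one≡ = cong (λ z → 1 + 2 * z) (sym (*-zeroʳ k))
  n<o : n < o n
  n<o = s≤s (≤-trans (m≤n*m n k {{>-nonZero 1≤k}}) (m≤n*m (k * n) 2))
  n≤m : n ≤ m
  n≤m = ≤-trans (<⇒≤ n<o) (m≤m+n (o n) (o n))
  n+2k≤2a : n + 2 * k ≤ 2 * a
  n+2k≤2a = ≤-trans (m≤m+n (n + 2 * k) (n + 2 * (n * k))) (≤-reflexive (eq n k (n * k)))
    where
    eq : ∀ n k c → n + 2 * k + (n + 2 * c) ≡ 2 * (k + (n + c))
    eq = solve-∀
  split = m≤n⇒∃[o]m+o≡n (≤-trans (m≤m+n n (2 * k)) n+2k≤2a)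
  d = proj₁ split
  n+d≡ : n + d ≡ 2 * a
  n+d≡ = proj₂ split
  T≈ : T a ≈[ n ] evenTails k a
  T≈ = recurrence-unique {s = o 0} 1≤k (tower-recurrence k 2≤k n 0 n<o)
    (subst (λ s → Recurrence n k s (evenTails k)) one≡ (evenTails-recurrence k 2≤k n))
    (λ j _ → trans (tower-zero k 2≤k n 0 j) (sym (tails-zero (CNext? k) 0 j))) a
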